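{- Let $G=(V,E)$ be a finite simple undirected graph and let $\kappa$ be a positive integer. Let $p$ be a path in $D$ with $\kappa-2$ arcs and let $\{v_1,v_2,\ldots,v_{\kappa-1}\}$ be its vertex set, listed in the order in which the vertices appear along $p$. If vertices $u,r\in V\setminus\{v_1,v_2,\ldots,v_{\kappa-1}\}$ exist such that $[v_1,u],[v_{\kappa-1},u]\in E$ and $[r,u]\in E$, then the inequality \[\sum_{(i,j)\in p} w_{ij}+w_{ur}+w_{ru}\le z\] is valid for $P_{G,\kappa}$.
   Context: Let $m=|E|$. Let $D=(V,A)$ be the directed graph with $A=\{(i,j),(j,i)\mid [i,j]\in E\}$. Paths are directed and elementary (no repeated vertices); paths and cycles are identified with their arc sets. (A path with $\kappa-2$ arcs exists only if $\kappa\ge 2$.) $P_\kappa(A)$ denotes the set of all paths in $D$ with exactly $\kappa$ arcs, and $C(A)$ the set of all directed (elementary) cycles in $D$ (including those of length 2), with $|C|$ the number of arcs of $C$. The polytope $P_{G,\kappa}$ is the convex hull of all $(w,z)\in\mathbb{R}^{2m}\times\mathbb{R}$, $w=(w_{ij})_{(i,j)\in A}$, satisfying (1) $w_{ij}+w_{ji}\le 1$ for all $[i,j]\in E$; (2) $\sum_{(i,j)\in C}w_{ij}\le |C|-1$ for all $C\in C(A)$; (3) $\sum_{(i,j)\in p}w_{ij}\le z$ for all $p\in P_\kappa(A)$; (4) $w_{ij}\in\{0,1\}$ for all $(i,j)\in A$; (5) $0\le z\le\kappa$. An inequality is valid for $P_{G,\kappa}$ if every point of $P_{G,\kappa}$ satisfies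 it. -}

module Defs where

open import Level using (0ℓ)
open import Algebra.Bundles using (CommutativeMonoid; RawMonoid)
import Algebra.Definitions.RawMonoid as RawMonoidDefinitions
import Algebra.Properties.CommutativeSemigroup as CommutativeSemigroupProperties
import Algebra.Properties.Group as GroupProperties
open import Data.Fin.Base using (Fin; zero; suc; inject₁; fromℕ)
import Data.Integer.Base as ℤ
open import Data.Nat.Base as ℕ using (ℕ; suc)
import Data.Nat.Properties as ℕₚ
open import Data.Product.Base using (∃; _×_; _,_; proj₁; proj₂)
open import Data.Rational.Base as ℚ using (ℚ; 0ℚ; 1ℚ; ½)
import Data.Rational.Properties as ℚₚ
open import Data.Sum.Base using (_⊎_)
open import Data.Vec.Functional using (Vector)
open import Function.Definitions using (Injective)
open import Relation.Binary.Core using (Rel)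
open import Relation.Binary.Definitions
  using (Decidable; Irreflexive; Symmetric)
open import Relation.Binary.PropositionalEquality
  using (_≡_; sym; cong; cong₂; subst; module ≡-Reasoning)
open import Relation.Unary using (Pred; _⊆_)

IsCauchy : (ℕ → ℚ) → Set
IsCauchy a = ∀ ε → 0ℚ ℚ.< ε →
  ∃ λ N → ∀ m n → N ℕ.≤ m → N ℕ.≤ n → ℚ.∣ a m ℚ.- a n ∣ ℚ.≤ ε

private abstract
  split-+ : ∀ x y x′ y′ →
    (x ℚ.+ y) ℚ.- (x′ ℚ.+ y′) ≡ (x ℚ.- x′) ℚ.+ (y ℚ.- y′)
  split-+ x y x′ y′ = begin
    (x ℚ.+ y) ℚ.- (x′ ℚ.+ y′)
      ≡⟨ cong (x ℚ.+ y ℚ.+_) (ℚₚ.neg-distrib-+ x′ y′) ⟩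
    (x ℚ.+ y) ℚ.+ (ℚ.- x′ ℚ.+ ℚ.- y′)
      ≡⟨ interchange x y (ℚ.- x′) (ℚ.- y′) ⟩
    (x ℚ.- x′) ℚ.+ (y ℚ.- y′) ∎
    where
    open ≡-Reasoning
    open CommutativeSemigroupProperties
      (CommutativeMonoid.commutativeSemigroup ℚₚ.+-0-commutativeMonoid)
      using (interchange)

  telescope : ∀ x y z → x ℚ.- z ≡ (x ℚ.- y) ℚ.+ (y ℚ.- z)
  telescope x y z = begin
    x ℚ.- z                         ≡⟨ cong (ℚ._- z) (ℚₚ.+-identityʳ x) ⟨
    x ℚ.+ 0ℚ ℚ.- z                  ≡⟨ cong (λ t → x ℚ.+ t ℚ.- z) (ℚₚ.+-inverseˡ y) ⟨
    x ℚ.+ (ℚ.- y ℚ.+ y) ℚ.- z       ≡⟨ cong (ℚ._- z) (ℚₚ.+-assoc x (ℚ.- y) y) ⟨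
    (x ℚ.- y) ℚ.+ y ℚ.- z           ≡⟨ ℚₚ.+-assoc (x ℚ.- y) y (ℚ.- z) ⟩
    (x ℚ.- y) ℚ.+ (y ℚ.- z)         ∎
    where open ≡-Reasoning

  *-distribˡ-- : ∀ x y z → x ℚ.* (y ℚ.- z) ≡ x ℚ.* y ℚ.- x ℚ.* z
  *-distribˡ-- x y z = begin
    x ℚ.* (y ℚ.- z)             ≡⟨ ℚₚ.*-distribˡ-+ x y (ℚ.- z) ⟩
    x ℚ.* y ℚ.+ x ℚ.* (ℚ.- z)   ≡⟨ cong (x ℚ.* y ℚ.+_) (ℚₚ.neg-distribʳ-* x z) ⟨
    x ℚ.* y ℚ.- x ℚ.* z         ∎
    where open ≡-Reasoning

  split-* : ∀ x y x′ y′ →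
    x ℚ.* y ℚ.- x′ ℚ.* y′ ≡ x ℚ.* (y ℚ.- y′) ℚ.+ y′ ℚ.* (x ℚ.- x′)
  split-* x y x′ y′ = begin
    x ℚ.* y ℚ.- x′ ℚ.* y′
      ≡⟨ telescope (x ℚ.* y) (x ℚ.* y′) (x′ ℚ.* y′) ⟩
    (x ℚ.* y ℚ.- x ℚ.* y′) ℚ.+ (x ℚ.* y′ ℚ.- x′ ℚ.* y′)
      ≡⟨ cong₂ (λ s t → (x ℚ.* y ℚ.- x ℚ.* y′) ℚ.+ (s ℚ.- t))
               (ℚₚ.*-comm x y′) (ℚₚ.*-comm x′ y′) ⟩
    (x ℚ.* y ℚ.- x ℚ.* y′) ℚ.+ (y′ ℚ.* x ℚ.- y′ ℚ.* x′)
      ≡⟨ cong₂ ℚ._+_ (*-distribˡ-- x y y′) (*-distribˡ-- y′ x x′) ⟨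
    x ℚ.* (y ℚ.- y′) ℚ.+ y′ ℚ.* (x ℚ.- x′) ∎
    where open ≡-Reasoning

  ½+½ : ∀ ε → ½ ℚ.* ε ℚ.+ ½ ℚ.* ε ≡ ε
  ½+½ ε = begin
    ½ ℚ.* ε ℚ.+ ½ ℚ.* ε   ≡⟨ ℚₚ.*-distribʳ-+ ε ½ ½ ⟨
    1ℚ ℚ.* ε              ≡⟨ ℚₚ.*-identityˡ ε ⟩
    ε                     ∎
    where open ≡-Reasoning

  0<½*ε : ∀ {ε} → 0ℚ ℚ.< ε → 0ℚ ℚ.< ½ ℚ.* ε
  0<½*ε {ε} 0<ε =
    ℚₚ.positive⁻¹ _ {{ℚₚ.pos*pos⇒pos ½ ε {{ℚ.positive 0<ε}}}}

  +-cauchy : ∀ {a b} → IsCauchy a → IsCauchy b →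
             IsCauchy (λ n → a n ℚ.+ b n)
  +-cauchy {a} {b} ca cb ε 0<ε
    with M , p ← ca (½ ℚ.* ε) (0<½*ε 0<ε)
       | N , q ← cb (½ ℚ.* ε) (0<½*ε 0<ε) = M ℕ.⊔ N , bound
    where
    open ℚₚ.≤-Reasoning
    bound : ∀ m n → M ℕ.⊔ N ℕ.≤ m → M ℕ.⊔ N ℕ.≤ n →
            ℚ.∣ (a m ℚ.+ b m) ℚ.- (a n ℚ.+ b n) ∣ ℚ.≤ ε
    bound m n h k = begin
      ℚ.∣ (a m ℚ.+ b m) ℚ.- (a n ℚ.+ b n) ∣
        ≡⟨ cong ℚ.∣_∣ (split-+ (a m) (b m) (a n) (b n)) ⟩
      ℚ.∣ (a m ℚ.- a n) ℚ.+ (b m ℚ.- b n) ∣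
        ≤⟨ ℚₚ.∣p+q∣≤∣p∣+∣q∣ (a m ℚ.- a n) (b m ℚ.- b n) ⟩
      ℚ.∣ a m ℚ.- a n ∣ ℚ.+ ℚ.∣ b m ℚ.- b n ∣
        ≤⟨ ℚₚ.+-mono-≤
             (p m n (ℕₚ.m⊔n≤o⇒m≤o M N h) (ℕₚ.m⊔n≤o⇒m≤o M N k))
             (q m n (ℕₚ.m⊔n≤o⇒n≤o M N h) (ℕₚ.m⊔n≤o⇒n≤o M N k)) ⟩
      ½ ℚ.* ε ℚ.+ ½ ℚ.* ε
        ≡⟨ ½+½ ε ⟩
      ε ∎

  eventuallyBounded : ∀ {a} → IsCauchy a →
    ∃ λ B → ℚ.Positive B × ∃ λ N → ∀ n → N ℕ.≤ n → ℚ.∣ a n ∣ ℚ.≤ B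
  eventuallyBounded {a} ca with N , p ← ca 1ℚ (ℚₚ.positive⁻¹ 1ℚ) =
    1ℚ ℚ.+ ℚ.∣ a N ∣ ,
    ℚₚ.pos+nonNeg⇒pos 1ℚ ℚ.∣ a N ∣ {{ℚₚ.∣-∣-nonNeg (a N)}} ,
    N , bound
    where
    open ℚₚ.≤-Reasoning
    open GroupProperties ℚₚ.+-0-group using (//-rightDividesˡ)
    bound : ∀ n → N ℕ.≤ n → ℚ.∣ a n ∣ ℚ.≤ 1ℚ ℚ.+ ℚ.∣ a N ∣
    bound n N≤n = begin
      ℚ.∣ a n ∣
        ≡⟨ cong ℚ.∣_∣ (//-rightDividesˡ (a N) (a n)) ⟨
      ℚ.∣ (a n ℚ.- a N) ℚ.+ a N ∣
        ≤⟨ ℚₚ.∣p+q∣≤∣p∣+∣q∣ (a n ℚ.- a N) (a N) ⟩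
      ℚ.∣ a n ℚ.- a N ∣ ℚ.+ ℚ.∣ a N ∣
        ≤⟨ ℚₚ.+-monoˡ-≤ ℚ.∣ a N ∣ (p n N N≤n ℕₚ.≤-refl) ⟩
      1ℚ ℚ.+ ℚ.∣ a N ∣ ∎

  ∣*∣-mono : ∀ {x y B δ} → 0ℚ ℚ.≤ δ → ℚ.∣ x ∣ ℚ.≤ B → ℚ.∣ y ∣ ℚ.≤ δ →
             ℚ.∣ x ℚ.* y ∣ ℚ.≤ B ℚ.* δ
  ∣*∣-mono {x} {y} {B} {δ} 0≤δ x≤B y≤δ = begin
    ℚ.∣ x ℚ.* y ∣
      ≡⟨ ℚₚ.∣p*q∣≡∣p∣*∣q∣ x y ⟩
    ℚ.∣ x ∣ ℚ.* ℚ.∣ y ∣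
      ≤⟨ ℚₚ.*-monoˡ-≤-nonNeg ℚ.∣ x ∣ {{ℚₚ.∣-∣-nonNeg x}} y≤δ ⟩
    ℚ.∣ x ∣ ℚ.* δ
      ≤⟨ ℚₚ.*-monoʳ-≤-nonNeg δ {{ℚ.nonNegative 0≤δ}} x≤B ⟩
    B ℚ.* δ ∎
    where open ℚₚ.≤-Reasoning

  -- If |a| ≤ A and |b| ≤ B eventually, then precision ε for a * b follows
  -- from precision ε / (A + B) for a and for b.
  *-cauchy : ∀ {a b} → IsCauchy a → IsCauchy b →
             IsCauchy (λ n → a n ℚ.* b n)
  *-cauchy {a} {b} ca cb ε 0<ε
    with A , A>0 , K , a≤A ← eventuallyBounded ca
       | B , B>0 , L , b≤B ← eventuallyBounded cb
    = let M , p = ca δ 0<δ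
          N , q = cb δ 0<δ
      in (K ℕ.⊔ L) ℕ.⊔ (M ℕ.⊔ N) , λ m n h k →
         let KL≤n = ℕₚ.m⊔n≤o⇒m≤o (K ℕ.⊔ L) (M ℕ.⊔ N) k
             KL≤m = ℕₚ.m⊔n≤o⇒m≤o (K ℕ.⊔ L) (M ℕ.⊔ N) h
             MN≤n = ℕₚ.m⊔n≤o⇒n≤o (K ℕ.⊔ L) (M ℕ.⊔ N) k
             MN≤m = ℕₚ.m⊔n≤o⇒n≤o (K ℕ.⊔ L) (M ℕ.⊔ N) h
         in bound m n
              (a≤A m (ℕₚ.m⊔n≤o⇒m≤o K L KL≤m))
              (b≤B n (ℕₚ.m⊔n≤o⇒n≤o K L KL≤n))
              (p m n (ℕₚ.m⊔n≤o⇒m≤o M N MN≤m) (ℕₚ.m⊔n≤o⇒m≤o M N MN≤n))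
              (q m n (ℕₚ.m⊔n≤o⇒n≤o M N MN≤m) (ℕₚ.m⊔n≤o⇒n≤o M N MN≤n))
    where
    open ℚₚ.≤-Reasoning
    C : ℚ
    C = A ℚ.+ B
    instance
      C-pos : ℚ.Positive C
      C-pos = ℚₚ.pos+pos⇒pos A {{A>0}} B {{B>0}}
      C-nonZero : ℚ.NonZero C
      C-nonZero = ℚₚ.pos⇒nonZero C
    δ : ℚ
    δ = ℚ.1/ C ℚ.* ε
    0<δ : 0ℚ ℚ.< δ
    0<δ = ℚₚ.positive⁻¹ δ
      {{ℚₚ.pos*pos⇒pos (ℚ.1/ C) {{ℚₚ.1/pos⇒pos C}} ε {{ℚ.positive 0<ε}}}}
    bound : ∀ m n → ℚ.∣ a m ∣ ℚ.≤ A → ℚ.∣ b n ∣ ℚ.≤ B →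
            ℚ.∣ a m ℚ.- a n ∣ ℚ.≤ δ → ℚ.∣ b m ℚ.- b n ∣ ℚ.≤ δ →
            ℚ.∣ a m ℚ.* b m ℚ.- a n ℚ.* b n ∣ ℚ.≤ ε
    bound m n am≤A bn≤B da db = begin
      ℚ.∣ a m ℚ.* b m ℚ.- a n ℚ.* b n ∣
        ≡⟨ cong ℚ.∣_∣ (split-* (a m) (b m) (a n) (b n)) ⟩
      ℚ.∣ a m ℚ.* (b m ℚ.- b n) ℚ.+ b n ℚ.* (a m ℚ.- a n) ∣
        ≤⟨ ℚₚ.∣p+q∣≤∣p∣+∣q∣
             (a m ℚ.* (b m ℚ.- b n)) (b n ℚ.* (a m ℚ.- a n)) ⟩
      ℚ.∣ a m ℚ.* (b m ℚ.- b n) ∣ ℚ.+ ℚ.∣ b n ℚ.* (a m ℚ.- a n) ∣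
        ≤⟨ ℚₚ.+-mono-≤ (∣*∣-mono {a m} (ℚₚ.<⇒≤ 0<δ) am≤A db)
                       (∣*∣-mono {b n} (ℚₚ.<⇒≤ 0<δ) bn≤B da) ⟩
      A ℚ.* δ ℚ.+ B ℚ.* δ
        ≡⟨ ℚₚ.*-distribʳ-+ δ A B ⟨
      C ℚ.* (ℚ.1/ C ℚ.* ε)
        ≡⟨ ℚₚ.*-assoc C (ℚ.1/ C) ε ⟨
      (C ℚ.* ℚ.1/ C) ℚ.* ε
        ≡⟨ cong (ℚ._* ε) (ℚₚ.*-inverseʳ C) ⟩
      1ℚ ℚ.* ε
        ≡⟨ ℚₚ.*-identityˡ ε ⟩
      ε ∎

  const-cauchy : ∀ q → IsCauchy (λ _ → q)
  const-cauchy q ε 0<ε = 0 , λ _ _ _ _ →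
    subst (λ d → ℚ.∣ d ∣ ℚ.≤ ε) (sym (ℚₚ.+-inverseʳ q)) (ℚₚ.<⇒≤ 0<ε)

-- Equality of reals is _≈_, not _≡_.
record ℝ : Set where
  constructor real
  field
    seq    : ℕ → ℚ
    cauchy : IsCauchy seq

open ℝ public

infix  4 _≈_ _≤_
infixl 6 _+_
infixl 7 _*_

record _≈_ (x y : ℝ) : Set where
  constructor mk≈
  field
    close : ∀ ε → 0ℚ ℚ.< ε →
      ∃ λ N → ∀ n → N ℕ.≤ n → ℚ.∣ seq x n ℚ.- seq y n ∣ ℚ.≤ ε

record _≤_ (x y : ℝ) : Set where
  constructor mk≤
  field
    below : ∀ ε → 0ℚ ℚ.< ε →
      ∃ λ N → ∀ n → N ℕ.≤ n → seq x n ℚ.≤ seq y n ℚ.+ ε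

_+_ : ℝ → ℝ → ℝ
x + y = real (λ n → seq x n ℚ.+ seq y n)
             (+-cauchy {seq x} {seq y} (cauchy x) (cauchy y))

_*_ : ℝ → ℝ → ℝ
x * y = real (λ n → seq x n ℚ.* seq y n)
             (*-cauchy {seq x} {seq y} (cauchy x) (cauchy y))

fromℚ : ℚ → ℝ
fromℚ q = real (λ _ → q) (const-cauchy q)

fromNat : ℕ → ℝ
fromNat n = fromℚ (ℤ.+ n ℚ./ 1)

0ℝ 1ℝ : ℝ
0ℝ = fromℚ 0ℚ
1ℝ = fromℚ 1ℚ

+-0-rawMonoid : RawMonoid 0ℓ 0ℓ
+-0-rawMonoid = record { Carrier = ℝ ; _≈_ = _≈_ ; _∙_ = _+_ ; ε = 0ℝ }

open RawMonoidDefinitions +-0-rawMonoid public using (sum)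

record Graph : Set₁ where
  field
    order     : ℕ

  V : Set
  V = Fin order

  field
    Adj       : Rel V 0ℓ
    adj?      : Decidable Adj
    symmetric : Symmetric Adj
    loopless  : Irreflexive _≡_ Adj

module _ (G : Graph) where
  open Graph G

  -- The adjacency proof is irrelevant, so an arc is determined by its
  -- ends and vectors indexed by arcs have exactly 2m coordinates.
  record Arc : Set where
    constructor arc
    field
      tail head : V
      .adjacent : Adj tail head

  reverse : Arc → Arc
  reverse (arc i j e) = arc j i (symmetric e)

  record Path (k : ℕ) : Set where
    field
      vertex     : Fin (suc k) → V
      elementary : Injective _≡_ _≡_ vertex
      adjacent   : ∀ i → Adj (vertex (inject₁ i)) (vertex (suc i))

    first last : V
    first = vertex zero
    last  = vertex (fromℕ k)

    arcs : Vector Arc k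
    arcs i = arc (vertex (inject₁ i)) (vertex (suc i)) (adjacent i)

  -- An elementary directed cycle, cut open at one of its vertices.  Cycles
  -- have at least two arcs because G is loopless.
  record Cycle : Set where
    field
      {size} : ℕ
      path   : Path size
      closes : Adj (Path.last path) (Path.first path)

    length : ℕ
    length = suc size

    closingArc : Arc
    closingArc = arc (Path.last path) (Path.first path) closes

  Point : Set
  Point = (Arc → ℝ) × ℝ

module _ {G : Graph} where

  pathWeight : ∀ {k} → (Arc G → ℝ) → Path G k → ℝ
  pathWeight w p = sum (λ i → w (Path.arcs p i))

  cycleWeight : (Arc G → ℝ) → Cycle G → ℝ
  cycleWeight w C = pathWeight w (Cycle.path C) + w (Cycle.closingArc C)

  ConvexHull : Pred (Point G) 0ℓ → Pred (Point G) 0ℓ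
  ConvexHull S (w , z) =
    ∃ λ N → ∃ λ (c : Vector ℝ N) → ∃ λ (x : Vector (Point G) N) →
      (∀ k → 0ℝ ≤ c k) ×
      sum c ≈ 1ℝ ×
      (∀ k → S (x k)) ×
      (∀ a → w a ≈ sum (λ k → c k * proj₁ (x k) a)) ×
      z ≈ sum (λ k → c k * proj₂ (x k))

  infix 4 _IsValidFor_

  _IsValidFor_ : Pred (Point G) 0ℓ → Pred (Point G) 0ℓ → Set
  ineq IsValidFor P = P ⊆ ineq

record Feasible (G : Graph) (κ : ℕ) (pt : Point G) : Set where
  w = proj₁ pt
  z = proj₂ pt
  field
    oneDirection : ∀ a → w a + w (reverse G a) ≤ 1ℝ
    acyclic      : ∀ (C : Cycle G) →
                   cycleWeight w C ≤ fromNat (Cycle.length C ℕ.∸ 1)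
    pathBound    : ∀ (p : Path G κ) → pathWeight w p ≤ z
    binary       : ∀ a → w a ≈ 0ℝ ⊎ w a ≈ 1ℝ
    z-lower      : 0ℝ ≤ z
    z-upper      : z ≤ fromNat κ

Polytope : (G : Graph) (κ : ℕ) → Pred (Point G) 0ℓ
Polytope G κ = ConvexHull (Feasible G κ)

{-# OPTIONS --safe #-}

-- A point satisfying (1) and (4) has w_ur = 0 or w_ru = 0.  If w_ru = 0, the
-- bound (3) on the path p, u, r gives the inequality; if w_ur = 0, the bound on
-- the path r, u, p does.  In both cases the path has κ arcs and the only further
-- weight, on the arc joining p to u, is nonnegative.  A linear inequality then
-- passes from the generating points to their convex hull.
module Submission where

open import Defs
open import Data.Nat.Base as ℕ using (ℕ; zero; suc)
open import Data.Product.Base using (∃; _×_; _,_; proj₁; proj₂)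
open import Relation.Binary.PropositionalEquality
  using (_≡_; _≢_; refl; sym; trans; cong; cong₂; subst; subst₂)

open import Level using (0ℓ)
open import Algebra.Bundles using (CommutativeMonoid)
import Algebra.Properties.CommutativeMonoid.Sum as CommutativeMonoidSum
open import Data.Fin.Base using (Fin; zero; suc; inject₁; fromℕ)
open import Data.Fin.Relation.Unary.Top
  using (View; ‵fromℕ; ‵inject₁; view; view-fromℕ; view-inject₁)
import Data.Nat.Properties as ℕₚ
open import Data.Rational.Base as ℚ using (ℚ; 0ℚ; 1ℚ; ½)
import Data.Rational.Properties as ℚₚ
open import Data.Rational.Solver using (module +-*-Solver)
open import Data.Sum.Base using (inj₁; inj₂)
open import Data.Vec.Functional using (Vector; _∷_)
open import Function.Base using (_∘_)
open import Function.Definitions using (Injective)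
open import Relation.Binary.Bundles using (Poset)
import Relation.Binary.Reasoning.PartialOrder as PartialOrderReasoning
open import Relation.Binary.Structures using (IsPartialOrder)
open import Relation.Nullary.Negation using (contradiction)
open import Relation.Unary using (Pred)

open +-*-Solver using (solve; con; _:+_; _:*_; _:-_; :-_; _:=_)

-- Eventual properties and rational estimates.

Eventually : Pred ℕ 0ℓ → Set
Eventually P = ∃ λ N → ∀ n → N ℕ.≤ n → P n

always : ∀ {P} → (∀ n → P n) → Eventually P
always p = 0 , λ n _ → p n

eventually₂ : ∀ {P Q R : Pred ℕ 0ℓ} → (∀ n → P n → Q n → R n) →
              Eventually P → Eventually Q → Eventually R
eventually₂ f (M , p) (N , q) = M ℕ.⊔ N , λ n h →
  f n (p n (ℕₚ.m⊔n≤o⇒m≤o M N h)) (q n (ℕₚ.m⊔n≤o⇒n≤o M N h))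

½*p+½*p≡p : ∀ ε → ½ ℚ.* ε ℚ.+ ½ ℚ.* ε ≡ ε
½*p+½*p≡p = solve 1 (λ e → con ½ :* e :+ con ½ :* e := e) refl

0<½*ε : ∀ {ε} → 0ℚ ℚ.< ε → 0ℚ ℚ.< ½ ℚ.* ε
0<½*ε {ε} 0<ε =
  ℚₚ.positive⁻¹ _ {{ℚₚ.pos*pos⇒pos ½ ε {{ℚ.positive 0<ε}}}}

p≤∣p∣ : ∀ p → p ℚ.≤ ℚ.∣ p ∣
p≤∣p∣ p with ℚₚ.≤-total 0ℚ p
... | inj₁ 0≤p = ℚₚ.≤-reflexive (sym (ℚₚ.0≤p⇒∣p∣≡p 0≤p))
... | inj₂ p≤0 = ℚₚ.≤-trans p≤0 (ℚₚ.0≤∣p∣ p)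

∣p-q∣≤ε⇒p≤q+ε : ∀ {p q ε} → ℚ.∣ p ℚ.- q ∣ ℚ.≤ ε → p ℚ.≤ q ℚ.+ ε
∣p-q∣≤ε⇒p≤q+ε {p} {q} {ε} h = begin
  p               ≡⟨ solve 2 (λ p q → p := q :+ (p :- q)) refl p q ⟩
  q ℚ.+ (p ℚ.- q) ≤⟨ ℚₚ.+-monoʳ-≤ q (ℚₚ.≤-trans (p≤∣p∣ _) h) ⟩
  q ℚ.+ ε         ∎
  where open ℚₚ.≤-Reasoning

p≤q+ε⇒p-q≤ε : ∀ {p q ε} → p ℚ.≤ q ℚ.+ ε → p ℚ.- q ℚ.≤ ε
p≤q+ε⇒p-q≤ε {p} {q} {ε} h = begin
  p ℚ.- q         ≤⟨ ℚₚ.+-monoˡ-≤ (ℚ.- q) h ⟩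
  q ℚ.+ ε ℚ.- q   ≡⟨ solve 2 (λ q e → q :+ e :- q := e) refl q ε ⟩
  ε               ∎
  where open ℚₚ.≤-Reasoning

∣p-q∣≤ε : ∀ {p q ε} → p ℚ.≤ q ℚ.+ ε → q ℚ.≤ p ℚ.+ ε → ℚ.∣ p ℚ.- q ∣ ℚ.≤ ε
∣p-q∣≤ε {p} {q} {ε} h k with ℚₚ.∣p∣≡p∨∣p∣≡-p (p ℚ.- q)
... | inj₁ eq = subst (ℚ._≤ ε) (sym eq) (p≤q+ε⇒p-q≤ε {p} {q} h)
... | inj₂ eq = subst (ℚ._≤ ε)
  (sym (trans eq (solve 2 (λ p q → :- (p :- q) := q :- p) refl p q)))
  (p≤q+ε⇒p-q≤ε {q} {p} k)

∣p-q∣≡∣q-p∣ : ∀ p q → ℚ.∣ p ℚ.- q ∣ ≡ ℚ.∣ q ℚ.- p ∣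
∣p-q∣≡∣q-p∣ p q = trans (sym (ℚₚ.∣-p∣≡∣p∣ (p ℚ.- q)))
  (cong ℚ.∣_∣ (solve 2 (λ p q → :- (p :- q) := q :- p) refl p q))

-- Supplies the tolerance for a factor that is only known to stay below `B`. The product is an
-- equality so that two such errors can be added up to exactly ε.
divide : ∀ B → 0ℚ ℚ.< B → ∀ {ε} → 0ℚ ℚ.< ε →
         ∃ λ δ → 0ℚ ℚ.< δ × δ ℚ.* B ≡ ε
divide B 0<B {ε} 0<ε = ε ℚ.* ℚ.1/ B ,
  ℚₚ.positive⁻¹ _ {{ℚₚ.pos*pos⇒pos ε {{ℚ.positive 0<ε}} (ℚ.1/ B) {{ℚₚ.1/pos⇒pos B}}}} ,
  trans (ℚₚ.*-assoc ε (ℚ.1/ B) B)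
    (trans (cong (ε ℚ.*_) (ℚₚ.*-inverseˡ B)) (ℚₚ.*-identityʳ ε))
  where
  instance
    B-pos : ℚ.Positive B
    B-pos = ℚ.positive 0<B
    B-nonZero : ℚ.NonZero B
    B-nonZero = ℚₚ.pos⇒nonZero B

-- Order and addition of Cauchy reals.

≤-pointwise : ∀ {x y} → (∀ n → seq x n ≡ seq y n) → x ≤ y
≤-pointwise {x} {y} eq = mk≤ λ ε 0<ε → always λ n → begin
  seq x n           ≡⟨ eq n ⟩
  seq y n           ≡⟨ ℚₚ.+-identityʳ (seq y n) ⟨
  seq y n ℚ.+ 0ℚ    ≤⟨ ℚₚ.+-monoʳ-≤ (seq y n) (ℚₚ.<⇒≤ 0<ε) ⟩
  seq y n ℚ.+ ε     ∎
  where open ℚₚ.≤-Reasoning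

≤-trans : ∀ {x y z} → x ≤ y → y ≤ z → x ≤ z
≤-trans {x} {y} {z} (mk≤ p) (mk≤ q) = mk≤ λ ε 0<ε → eventually₂
  (λ n h k → begin
    seq x n                             ≤⟨ h ⟩
    seq y n ℚ.+ ½ ℚ.* ε                 ≤⟨ ℚₚ.+-monoˡ-≤ (½ ℚ.* ε) k ⟩
    seq z n ℚ.+ ½ ℚ.* ε ℚ.+ ½ ℚ.* ε     ≡⟨ ℚₚ.+-assoc (seq z n) _ _ ⟩
    seq z n ℚ.+ (½ ℚ.* ε ℚ.+ ½ ℚ.* ε)   ≡⟨ cong (seq z n ℚ.+_) (½*p+½*p≡p ε) ⟩
    seq z n ℚ.+ ε                       ∎)
  (p _ (0<½*ε 0<ε)) (q _ (0<½*ε 0<ε))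
  where open ℚₚ.≤-Reasoning

+-mono-≤ : ∀ {x y u v} → x ≤ y → u ≤ v → x + u ≤ y + v
+-mono-≤ {x} {y} {u} {v} (mk≤ p) (mk≤ q) = mk≤ λ ε 0<ε → eventually₂
  (λ n h k → begin
    seq x n ℚ.+ seq u n                                     ≤⟨ ℚₚ.+-mono-≤ h k ⟩
    (seq y n ℚ.+ ½ ℚ.* ε) ℚ.+ (seq v n ℚ.+ ½ ℚ.* ε)
      ≡⟨ solve 3 (λ y v h → (y :+ h) :+ (v :+ h) := y :+ v :+ (h :+ h)) refl
           (seq y n) (seq v n) (½ ℚ.* ε) ⟩
    seq y n ℚ.+ seq v n ℚ.+ (½ ℚ.* ε ℚ.+ ½ ℚ.* ε)
      ≡⟨ cong (seq y n ℚ.+ seq v n ℚ.+_) (½*p+½*p≡p ε) ⟩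
    seq y n ℚ.+ seq v n ℚ.+ ε                               ∎)
  (p _ (0<½*ε 0<ε)) (q _ (0<½*ε 0<ε))
  where open ℚₚ.≤-Reasoning

≈-sym : ∀ {x y} → x ≈ y → y ≈ x
≈-sym {x} {y} (mk≈ p) = mk≈ λ ε 0<ε → proj₁ (p ε 0<ε) , λ n h →
  subst (ℚ._≤ ε) (∣p-q∣≡∣q-p∣ (seq x n) (seq y n)) (proj₂ (p ε 0<ε) n h)

≈⇒≤ : ∀ {x y} → x ≈ y → x ≤ y
≈⇒≤ (mk≈ p) = mk≤ λ ε 0<ε → proj₁ (p ε 0<ε) , λ n h →
  ∣p-q∣≤ε⇒p≤q+ε (proj₂ (p ε 0<ε) n h)

≈⇒≥ : ∀ {x y} → x ≈ y → y ≤ x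
≈⇒≥ = ≈⇒≤ ∘ ≈-sym

-- The two one-sided estimates bound the difference from both sides. Transitivity of `_≈_` and
-- `+-cong` are derived through this lemma, so the splitting of ε into halves is done only for
-- `_≤_`.
≤-antisym : ∀ {x y} → x ≤ y → y ≤ x → x ≈ y
≤-antisym (mk≤ p) (mk≤ q) = mk≈ λ ε 0<ε →
  eventually₂ (λ _ → ∣p-q∣≤ε) (p ε 0<ε) (q ε 0<ε)

-- The operations act term by term on the sequences, so algebraic laws of ℚ pass to the reals this
-- way without any estimate.
≈-pointwise : ∀ {x y} → (∀ n → seq x n ≡ seq y n) → x ≈ y
≈-pointwise eq = ≤-antisym (≤-pointwise eq) (≤-pointwise (sym ∘ eq))

≤-isPartialOrder : IsPartialOrder _≈_ _≤_
≤-isPartialOrder = record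
  { isPreorder = record
    { isEquivalence = record
      { refl  = ≈-pointwise λ _ → refl
      ; sym   = ≈-sym
      ; trans = λ p q → ≤-antisym (≤-trans (≈⇒≤ p) (≈⇒≤ q))
                                  (≤-trans (≈⇒≥ q) (≈⇒≥ p))
      }
    ; reflexive = ≈⇒≤
    ; trans     = ≤-trans
    }
  ; antisym = ≤-antisym
  }

≤-poset : Poset 0ℓ 0ℓ 0ℓ
≤-poset = record { isPartialOrder = ≤-isPartialOrder }

open Poset ≤-poset using () renaming (refl to ≤-refl; module Eq to ≈)
module ≤-Reasoning = PartialOrderReasoning ≤-poset

+-cong : ∀ {x y u v} → x ≈ y → u ≈ v → x + u ≈ y + v
+-cong p q = ≤-antisym (+-mono-≤ (≈⇒≤ p) (≈⇒≤ q)) (+-mono-≤ (≈⇒≥ p) (≈⇒≥ q))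

+-0-commutativeMonoid : CommutativeMonoid 0ℓ 0ℓ
+-0-commutativeMonoid = record
  { _≈_ = _≈_
  ; _∙_ = _+_
  ; ε   = 0ℝ
  ; isCommutativeMonoid = record
    { isMonoid = record
      { isSemigroup = record
        { isMagma = record { isEquivalence = ≈.isEquivalence ; ∙-cong = +-cong }
        ; assoc   = λ x y z → ≈-pointwise λ n →
            ℚₚ.+-assoc (seq x n) (seq y n) (seq z n)
        }
      ; identity = (λ x → ≈-pointwise λ n → ℚₚ.+-identityˡ (seq x n))
                 , (λ x → ≈-pointwise λ n → ℚₚ.+-identityʳ (seq x n))
      }
    ; comm = λ x y → ≈-pointwise λ n → ℚₚ.+-comm (seq x n) (seq y n)
    }
  }

open CommutativeMonoid +-0-commutativeMonoid using ()
  renaming ( assoc to +-assoc; comm to +-comm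
           ; identityˡ to +-identityˡ; identityʳ to +-identityʳ )
open CommutativeMonoidSum +-0-commutativeMonoid
  using (sum-cong-≋; sum-init-last; ∑-comm)

-- Multiplication and its compatibility with the order.

*-distribˡ-+ : ∀ x y z → x * (y + z) ≈ x * y + x * z
*-distribˡ-+ x y z = ≈-pointwise λ n →
  ℚₚ.*-distribˡ-+ (seq x n) (seq y n) (seq z n)

*-zeroʳ : ∀ x → x * 0ℝ ≈ 0ℝ
*-zeroʳ x = ≈-pointwise λ n → ℚₚ.*-zeroʳ (seq x n)

-- By the Cauchy condition at 1, all late terms lie within 1 of `seq x N`. The absolute value in `B`
-- makes the bound positive, as `divide` requires.
eventuallyBelow : ∀ x → ∃ λ B → 0ℚ ℚ.< B × Eventually (λ n → seq x n ℚ.≤ B)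
eventuallyBelow x with N , p ← cauchy x 1ℚ (ℚₚ.positive⁻¹ 1ℚ) =
  B , ℚₚ.positive⁻¹ B {{ℚₚ.nonNeg+pos⇒pos ℚ.∣ seq x N ∣ {{ℚₚ.∣-∣-nonNeg (seq x N)}} 1ℚ}} ,
  N , λ n h → ℚₚ.≤-trans (∣p-q∣≤ε⇒p≤q+ε (p n N h ℕₚ.≤-refl))
    (ℚₚ.+-monoˡ-≤ 1ℚ (p≤∣p∣ (seq x N)))
  where
  B : ℚ
  B = ℚ.∣ seq x N ∣ ℚ.+ 1ℚ

-- The factor `c` may be negative but `c + δ` is not, so `x ≤ y + δ′` is multiplied by `c + δ` and
-- `δ * x` is taken away again. The surplus over `c * y` is then exactly
-- `δ * (y - x) + δ′ * (c + δ)`. The difference is written `y + (- 1) * x` to match the terms of the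
-- real number that bounds it.
*-almost-monoˡ-≤ : ∀ c x y {δ δ′ C D} → 0ℚ ℚ.≤ δ → 0ℚ ℚ.≤ δ′ →
  0ℚ ℚ.≤ c ℚ.+ δ → x ℚ.≤ y ℚ.+ δ′ → c ℚ.≤ C → y ℚ.+ (ℚ.- 1ℚ) ℚ.* x ℚ.≤ D →
  c ℚ.* x ℚ.≤ c ℚ.* y ℚ.+ (δ ℚ.* D ℚ.+ δ′ ℚ.* (C ℚ.+ δ))
*-almost-monoˡ-≤ c x y {δ} {δ′} {C} {D} 0≤δ 0≤δ′ 0≤c+δ x≤y+δ′ c≤C y-x≤D = begin
  c ℚ.* x
    ≡⟨ solve 3 (λ c x δ → c :* x := (c :+ δ) :* x :- δ :* x) refl c x δ ⟩
  (c ℚ.+ δ) ℚ.* x ℚ.- δ ℚ.* x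
    ≤⟨ ℚₚ.+-monoˡ-≤ (ℚ.- (δ ℚ.* x))
         (ℚₚ.*-monoˡ-≤-nonNeg (c ℚ.+ δ) {{ℚ.nonNegative 0≤c+δ}} x≤y+δ′) ⟩
  (c ℚ.+ δ) ℚ.* (y ℚ.+ δ′) ℚ.- δ ℚ.* x
    ≡⟨ solve 5 (λ c x y δ δ′ → (c :+ δ) :* (y :+ δ′) :- δ :* x :=
         c :* y :+ (δ :* (y :+ con (ℚ.- 1ℚ) :* x) :+ δ′ :* (c :+ δ)))
         refl c x y δ δ′ ⟩
  c ℚ.* y ℚ.+ (δ ℚ.* (y ℚ.+ (ℚ.- 1ℚ) ℚ.* x) ℚ.+ δ′ ℚ.* (c ℚ.+ δ))
    ≤⟨ ℚₚ.+-monoʳ-≤ (c ℚ.* y) (ℚₚ.+-mono-≤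
         (ℚₚ.*-monoˡ-≤-nonNeg δ {{ℚ.nonNegative 0≤δ}} y-x≤D)
         (ℚₚ.*-monoˡ-≤-nonNeg δ′ {{ℚ.nonNegative 0≤δ′}} (ℚₚ.+-monoˡ-≤ δ c≤C))) ⟩
  c ℚ.* y ℚ.+ (δ ℚ.* D ℚ.+ δ′ ℚ.* (C ℚ.+ δ)) ∎
  where open ℚₚ.≤-Reasoning

-- A real c ≥ 0 may have negative approximants, so the error terms δ and δ′ are
-- multiplied by upper bounds D of y − x and C + δ of c + δ; choosing first δ
-- and then δ′ makes both products ε/2.
*-monoˡ-≤ : ∀ {c x y} → 0ℝ ≤ c → x ≤ y → c * x ≤ c * y
*-monoˡ-≤ {c} {x} {y} (mk≤ 0≤c) (mk≤ x≤y) = mk≤ λ ε 0<ε →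
  let C , 0<C , c≤C = eventuallyBelow c
      D , 0<D , y-x≤D = eventuallyBelow (y + fromℚ (ℚ.- 1ℚ) * x)
      δ , 0<δ , δD≡½ε = divide D 0<D (0<½*ε 0<ε)
      δ′ , 0<δ′ , δ′[C+δ]≡½ε = divide (C ℚ.+ δ) (ℚₚ.+-mono-< 0<C 0<δ) (0<½*ε 0<ε)
  in eventually₂
    (λ n (c≤C , y-x≤D) (0≤c+δ , x≤y+δ′) → subst
      (λ e → seq c n ℚ.* seq x n ℚ.≤ seq c n ℚ.* seq y n ℚ.+ e)
      (trans (cong₂ ℚ._+_ δD≡½ε δ′[C+δ]≡½ε) (½*p+½*p≡p ε))
      (*-almost-monoˡ-≤ (seq c n) (seq x n) (seq y n) (ℚₚ.<⇒≤ 0<δ) (ℚₚ.<⇒≤ 0<δ′)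
        0≤c+δ x≤y+δ′ c≤C y-x≤D))
    (eventually₂ (λ _ → _,_) c≤C y-x≤D)
    (eventually₂ (λ _ → _,_) (0≤c δ 0<δ) (x≤y δ′ 0<δ′))

x≤x+y : ∀ {x y} → 0ℝ ≤ y → x ≤ x + y
x≤x+y {x} {y} 0≤y = begin
  x       ≈⟨ +-identityʳ x ⟨
  x + 0ℝ  ≤⟨ +-mono-≤ ≤-refl 0≤y ⟩
  x + y   ∎
  where open ≤-Reasoning

x≈1∧x+y≤1⇒y≤0 : ∀ {x y} → x ≈ 1ℝ → x + y ≤ 1ℝ → y ≤ 0ℝ
x≈1∧x+y≤1⇒y≤0 {x} {y} x≈1 x+y≤1 = begin
  y                ≈⟨ +-identityˡ y ⟨
  0ℝ + y           ≈⟨ +-cong -1+1≈0 ≈.refl ⟨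
  -1ℝ + 1ℝ + y     ≈⟨ +-assoc -1ℝ 1ℝ y ⟩
  -1ℝ + (1ℝ + y)   ≈⟨ +-cong ≈.refl (+-cong x≈1 ≈.refl) ⟨
  -1ℝ + (x + y)    ≤⟨ +-mono-≤ ≤-refl x+y≤1 ⟩
  -1ℝ + 1ℝ         ≈⟨ -1+1≈0 ⟩
  0ℝ               ∎
  where
  open ≤-Reasoning
  -1ℝ : ℝ
  -1ℝ = fromℚ (ℚ.- 1ℚ)
  -1+1≈0 : -1ℝ + 1ℝ ≈ 0ℝ
  -1+1≈0 = ≈-pointwise λ _ → refl

-- Finite sums and convex combinations.

sum-mono-≤ : ∀ {n} {s t : Vector ℝ n} → (∀ i → s i ≤ t i) → sum s ≤ sum t
sum-mono-≤ {zero}  _ = ≤-refl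
sum-mono-≤ {suc _} h = +-mono-≤ (h zero) (sum-mono-≤ (h ∘ suc))

*-distribˡ-sum : ∀ {n} x (t : Vector ℝ n) → x * sum t ≈ sum λ i → x * t i
*-distribˡ-sum {zero}  x _ = *-zeroʳ x
*-distribˡ-sum {suc _} x t = ≈.trans (*-distribˡ-+ x (t zero) (sum (t ∘ suc)))
  (+-cong ≈.refl (*-distribˡ-sum x (t ∘ suc)))

module _ {G : Graph} where
  open Graph G

  -- Exchanging the sums over arcs and over generators turns the left side into a combination of its
  -- values at the generators, where `valid` applies term by term. An arbitrary vector of arcs is
  -- allowed so that a path and two extra arcs form one sum.
  convexHull-sum-≤ : ∀ {n} {S : Pred (Point G) 0ℓ} (as : Vector (Arc G) n) →
    (∀ pt → S pt → sum (proj₁ pt ∘ as) ≤ proj₂ pt) →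
    ∀ pt → ConvexHull S pt → sum (proj₁ pt ∘ as) ≤ proj₂ pt
  convexHull-sum-≤ as valid (w , z) (N , c , x , 0≤c , _ , x∈S , w≈ , z≈) = begin
    sum (w ∘ as)
      ≈⟨ sum-cong-≋ (w≈ ∘ as) ⟩
    sum (λ i → sum (λ k → c k * proj₁ (x k) (as i)))
      ≈⟨ ∑-comm (λ i k → c k * proj₁ (x k) (as i)) ⟩
    sum (λ k → sum (λ i → c k * proj₁ (x k) (as i)))
      ≈⟨ sum-cong-≋ (λ k → *-distribˡ-sum (c k) (proj₁ (x k) ∘ as)) ⟨
    sum (λ k → c k * sum (proj₁ (x k) ∘ as))
      ≤⟨ sum-mono-≤ (λ k → *-monoˡ-≤ (0≤c k) (valid (x k) (x∈S k))) ⟩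
    sum (λ k → c k * proj₂ (x k))
      ≈⟨ z≈ ⟨
    z ∎
    where open ≤-Reasoning

  -- Lengthening a path at either end.

  cons : ∀ {k} {v} (p : Path G k) → (∀ i → Path.vertex p i ≢ v) →
         Adj v (Path.first p) → Path G (suc k)
  cons {v = v} p v∉p e = record
    { vertex     = v ∷ vertex
    ; elementary = injective
    ; adjacent   = λ { zero → e ; (suc i) → adjacent i }
    }
    where
    open Path p
    injective : Injective _≡_ _≡_ (v ∷ vertex)
    injective {zero}  {zero}  _  = refl
    injective {zero}  {suc j} eq = contradiction (sym eq) (v∉p j)
    injective {suc i} {zero}  eq = contradiction eq (v∉p i)
    injective {suc i} {suc j} eq = cong suc (elementary eq)

  -- Once the ends are identified the arcs coincide, adjacency proofs being irrelevant. This is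
  -- needed because the ends of arcs in an appended path agree with the intended vertices only
  -- propositionally.
  arc-cong : ∀ (w : Arc G → ℝ) {i j i′ j′} .{a : Adj i j} .{b : Adj i′ j′} →
             i ≡ i′ → j ≡ j′ → w (arc i j a) ≡ w (arc i′ j′ b)
  arc-cong w refl refl = refl

  module Snoc {k v} (p : Path G k) (v∉p : ∀ i → Path.vertex p i ≢ v)
              (e : Adj (Path.last p) v) where
    open Path p

    -- The view separates the new last index from the old ones. Since it is an argument here, the
    -- two equations for `vertex′` are mere congruences, and injectivity is a case analysis on two
    -- views.
    at : ∀ {i : Fin (2 ℕ.+ k)} → View i → V
    at ‵fromℕ       = v
    at (‵inject₁ i) = vertex i

    vertex′ : Fin (2 ℕ.+ k) → V
    vertex′ i = at (view i)

    vertex′-inject₁ : ∀ i → vertex′ (inject₁ i) ≡ vertex i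
    vertex′-inject₁ i = cong at (view-inject₁ i)

    vertex′-fromℕ : vertex′ (fromℕ (suc k)) ≡ v
    vertex′-fromℕ = cong at (view-fromℕ (suc k))

    at-injective : ∀ {i j} (a : View i) (b : View j) → at a ≡ at b → i ≡ j
    at-injective ‵fromℕ       ‵fromℕ       _  = refl
    at-injective ‵fromℕ       (‵inject₁ j) eq = contradiction (sym eq) (v∉p j)
    at-injective (‵inject₁ i) ‵fromℕ       eq = contradiction eq (v∉p i)
    at-injective (‵inject₁ i) (‵inject₁ j) eq = cong inject₁ (elementary eq)

    at-adjacent : ∀ {i} → View i → Adj (vertex′ (inject₁ i)) (vertex′ (suc i))
    at-adjacent ‵fromℕ =
      subst₂ Adj (sym (vertex′-inject₁ (fromℕ k))) (sym vertex′-fromℕ) e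
    at-adjacent (‵inject₁ j) =
      -- `suc (inject₁ j)` computes to `inject₁ (suc j)`, so both ends are vertices of `p`.
      subst₂ Adj (sym (vertex′-inject₁ (inject₁ j))) (sym (vertex′-inject₁ (suc j)))
        (adjacent j)

    snoc : Path G (suc k)
    snoc = record
      { vertex     = vertex′
      ; elementary = λ {i} {j} → at-injective (view i) (view j)
      ; adjacent   = at-adjacent ∘ view
      }

    -- Provides the premise for appending a second vertex.
    avoids : ∀ {u} → (∀ i → vertex i ≢ u) → v ≢ u → ∀ i → vertex′ i ≢ u
    avoids u∉p v≢u i with view i
    ... | ‵fromℕ     = v≢u
    ... | ‵inject₁ j = u∉p j

    pathWeight-snoc : ∀ w → pathWeight w snoc ≈ pathWeight w p + w (arc last v e)
    pathWeight-snoc w = ≈.trans (sum-init-last (w ∘ Path.arcs snoc)) (+-cong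
      (sum-cong-≋ λ i → ≈.reflexive
        (arc-cong w (vertex′-inject₁ (inject₁ i)) (vertex′-inject₁ (suc i))))
      (≈.reflexive (arc-cong w (vertex′-inject₁ (fromℕ k)) vertex′-fromℕ)))

  -- The inequality at the generating points.

  weight-≥0 : ∀ {κ pt} → Feasible G κ pt → ∀ a → 0ℝ ≤ proj₁ pt a
  weight-≥0 feasible a with Feasible.binary feasible a
  ... | inj₁ w≈0 = ≈⇒≥ w≈0
  ... | inj₂ w≈1 = ≤-trans 0≤1 (≈⇒≥ w≈1)
    where
    0≤1 : 0ℝ ≤ 1ℝ
    0≤1 = mk≤ λ ε 0<ε → always λ _ →
      ℚₚ.<⇒≤ (ℚₚ.+-mono-< (ℚₚ.positive⁻¹ 1ℚ) 0<ε)

  -- The length `2 + k` is what two uses of `cons` or of `snoc` compute to, and the sum is nested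
  -- like the weight of the path r, u, p.
  feasible-≤ : ∀ {k} (p : Path G k) {u r} →
    (∀ i → Path.vertex p i ≢ u) → (∀ i → Path.vertex p i ≢ r) →
    Adj (Path.first p) u → Adj (Path.last p) u → (ru : Adj r u) →
    ∀ pt → Feasible G (2 ℕ.+ k) pt → let w = proj₁ pt in
    w (arc r u ru) + (w (arc u r (symmetric ru)) + pathWeight w p) ≤ proj₂ pt
  feasible-≤ p {u} {r} u∉p r∉p first-u last-u ru (w , z) feasible
    with Feasible.binary feasible (arc r u ru)
  ... | inj₁ w[ru]≈0 = begin
    w[ru] + (w[ur] + S)
      ≈⟨ +-cong w[ru]≈0 (+-comm w[ur] S) ⟩
    0ℝ + (S + w[ur])
      ≈⟨ +-identityˡ (S + w[ur]) ⟩
    S + w[ur]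
      ≤⟨ +-mono-≤ (x≤x+y (weight-≥0 feasible (arc last u last-u))) ≤-refl ⟩
    S + w (arc last u last-u) + w[ur]
      ≈⟨ +-cong (pu.pathWeight-snoc w) (≈.reflexive (arc-cong w pu.vertex′-fromℕ refl)) ⟨
    pathWeight w pu.snoc + w (arc (Path.last pu.snoc) r u-r)
      ≈⟨ pur.pathWeight-snoc w ⟨
    pathWeight w pur.snoc
      ≤⟨ Feasible.pathBound feasible pur.snoc ⟩
    z ∎
    where
    open ≤-Reasoning
    open Path p
    S w[ru] w[ur] : ℝ
    S = pathWeight w p
    w[ru] = w (arc r u ru)
    w[ur] = w (arc u r (symmetric ru))
    module pu = Snoc p u∉p last-u
    u-r : Adj (Path.last pu.snoc) r
    u-r = subst (λ v → Adj v r) (sym pu.vertex′-fromℕ) (symmetric ru)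
    module pur = Snoc pu.snoc (pu.avoids r∉p (λ u≡r → loopless (sym u≡r) ru)) u-r
  ... | inj₂ w[ru]≈1 = begin
    w[ru] + (w[ur] + S)
      -- Here `w[ur] ≤ 0`, and 0 is at most the weight of the arc from `u` to `first`. That weight
      -- takes the place of `w[ur]`, and the result is `pathWeight w rup` by computation.
      ≤⟨ +-mono-≤ ≤-refl (+-mono-≤
           (≤-trans
             (x≈1∧x+y≤1⇒y≤0 w[ru]≈1 (Feasible.oneDirection feasible (arc r u ru)))
             (weight-≥0 feasible (arc u first (symmetric first-u))))
           ≤-refl) ⟩
    pathWeight w rup
      ≤⟨ Feasible.pathBound feasible rup ⟩
    z ∎
    where
    open ≤-Reasoning
    open Path p
    S w[ru] w[ur] : ℝ
    S = pathWeight w p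
    w[ru] = w (arc r u ru)
    w[ur] = w (arc u r (symmetric ru))
    rup : Path G _
    rup = cons (cons p u∉p (symmetric first-u))
      (λ { zero u≡r → loopless (sym u≡r) ru ; (suc i) → r∉p i }) ru

theorem9 : (G : Graph) (κ : ℕ) → 0 ℕ.< κ →
    let open Graph G in
    ∀ {k} → k ℕ.+ 2 ≡ κ → (p : Path G k) →
    let open Path p in
    (u r : V) →
    (∀ i → vertex i ≢ u) → (∀ i → vertex i ≢ r) →
    Adj first u → Adj last u → (ru : Adj r u) →
    (λ (w , z) → pathWeight w p + w (arc u r (symmetric ru)) + w (arc r u ru) ≤ z) IsValidFor Polytope G κ
theorem9 G κ _ {k} k+2≡κ p u r u∉p r∉p first-u last-u ru {w , z} pt∈P = begin
  pathWeight w p + w ur + w (arc r u ru)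
    ≈⟨ +-comm (pathWeight w p + w ur) (w (arc r u ru)) ⟩
  w (arc r u ru) + (pathWeight w p + w ur)
    ≈⟨ +-cong ≈.refl (+-comm (pathWeight w p) (w ur)) ⟩
  -- This sum unfolds to the right-hand side reached by the two commutations.
  sum (w ∘ (arc r u ru ∷ ur ∷ Path.arcs p))
    ≤⟨ convexHull-sum-≤ (arc r u ru ∷ ur ∷ Path.arcs p) valid (w , z) pt∈P ⟩
  z ∎
  where
  open ≤-Reasoning
  ur : Arc G
  ur = arc u r (Graph.symmetric G ru)
  valid : ∀ pt → Feasible G κ pt →
          sum (proj₁ pt ∘ (arc r u ru ∷ ur ∷ Path.arcs p)) ≤ proj₂ pt
  valid pt = feasible-≤ p u∉p r∉p first-u last-u ru pt
    -- The given equation has `k + 2`, whereas the lengthened paths have `2 + k` arcs.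
    ∘ subst (λ κ → Feasible G κ pt) (trans (sym k+2≡κ) (ℕₚ.+-comm k 2))
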